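{- Let $Q_m(x,y,z,t)$ be defined by $Q_1=1$, $Q_{m+1}=[x+mz+(y+t)(m+y\partial_y)]Q_m$, and define $Q_{m,k}(x,t)$ by $Q_m(x,y,1,t)=\sum_{k=0}^{m-1}Q_{m,k}(x,t)y^k$. Let $r,n$ be integers with $1\le r<n$ and let $k\geq 0$. Then $$rQ_{n-r,k}(r,t)=\sum_{F\in\mathcal F_{n,k}^r}t^{{\rm eld}(F)}.$$
   Context: A plane tree is a rooted tree in which the children of each vertex are linearly ordered (left to right). A vertex $j$ is a descendant of $i$ if the path from the root to $j$ passes through $i$ (each vertex is its own descendant); $\beta(i)$ is the smallest descendant of $i$. A child $j$ of $v$ is elder if $v$ has a child $k$ to the right of $j$ with $\beta(k)<\beta(j)$. An edge $(i,j)$ ($j$ a child of $i$) is proper if $j$ is an elder child of $i$ or $i<\beta(j)$, and improper otherwise. A forest of $r$ plane trees on $[n]=\{1,\dots,n\}$ with roots $1,\dots,r$ is a collection of $r$ plane trees whose vertex sets partition $[n]$ and whose roots are $1,\dots,r$. For such a forest $F$, ${\rm eld}(F)$ is the total number of elder vertices and its improper edges are those of its trees. $\mathcal F_{n,k}^r$ is the set of such forests with exactly $k$ improper edges. -}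

module Defs where

open import Data.Nat using (ℕ; zero; suc; _+_; _*_; _^_; _⊓_; _<ᵇ_; _≡ᵇ_)
open import Data.Nat.Properties using (≤-decTotalOrder)
open import Data.Bool using (Bool; true; false; if_then_else_; _∧_; _∨_; not)
open import Data.List using (List; []; _∷_; _++_; map; applyUpTo)
open import Data.List.Sort ≤-decTotalOrder using (sort)
open import Data.Product using (Σ; _×_)
open import Relation.Binary.PropositionalEquality using (_≡_)

-- Polynomials in x, y, z, t with natural-number coefficients,
-- represented as finite formal sums of monomials  c · x^a y^b z^c t^d.

record Mono : Set where
  constructor mono
  field
    coeff : ℕ
    ex ey ez et : ℕ
open Mono public

Poly : Set
Poly = List Mono          -- the polynomial is the sum of its monomials

onePoly : Poly
onePoly = mono 1 0 0 0 0 ∷ []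

scale : ℕ → Poly → Poly
scale c = map (λ m → mono (c * coeff m) (ex m) (ey m) (ez m) (et m))

mulX mulY mulZ mulT : Poly → Poly
mulX = map (λ m → mono (coeff m) (suc (ex m)) (ey m) (ez m) (et m))
mulY = map (λ m → mono (coeff m) (ex m) (suc (ey m)) (ez m) (et m))
mulZ = map (λ m → mono (coeff m) (ex m) (ey m) (suc (ez m)) (et m))
mulT = map (λ m → mono (coeff m) (ex m) (ey m) (ez m) (suc (et m)))

yDy : Poly → Poly
yDy = map (λ m → mono (ey m * coeff m) (ex m) (ey m) (ez m) (et m))

stepOp : ℕ → Poly → Poly
stepOp m P = mulX P ++ scale m (mulZ P) ++ (mulY A ++ mulT A)
  where
  A : Poly
  A = scale m P ++ yDy P

-- Q m = Q_m(x,y,z,t) for m ≥ 1 :  Q_1 = 1,  Q_{m+1} = [x + m z + (y+t)(m + y∂_y)] Q_m.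
-- (Q 0 is not used by the paper; set to 0.)
Q : ℕ → Poly
Q zero = []
Q (suc zero) = onePoly
Q (suc (suc m)) = stepOp (suc m) (Q (suc m))

-- coeffQ m k r j = coefficient of t^j in Q_{m,k}(r,t), where
-- Q_m(x,y,1,t) = Σ_k Q_{m,k}(x,t) y^k.
coeffQ : ℕ → ℕ → ℕ → ℕ → ℕ
coeffQ m k r j = go (Q m)
  where
  go : Poly → ℕ
  go [] = 0
  go (mo ∷ ms) =
    (if (ey mo ≡ᵇ k) ∧ (et mo ≡ᵇ j) then coeff mo * r ^ ex mo else 0) + go ms

-- Plane trees with vertices labelled by natural numbers.
-- node v cs : root v with children subtrees cs, ordered left to right.

data Tree : Set where
  node : ℕ → List Tree → Tree

root : Tree → ℕ
root (node v _) = v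

mutual
  labels : Tree → List ℕ
  labels (node v cs) = v ∷ labelsF cs

  labelsF : List Tree → List ℕ
  labelsF [] = []
  labelsF (c ∷ cs) = labels c ++ labelsF cs

mutual
  β : Tree → ℕ
  β (node v cs) = minKids v cs

  minKids : ℕ → List Tree → ℕ
  minKids m [] = m
  minKids m (c ∷ cs) = minKids (m ⊓ β c) cs

-- child c, followed (to its right) by siblings rs, is elder iff some
-- sibling k to its right has β(k) < β(c)
isElder : Tree → List Tree → Bool
isElder c [] = false
isElder c (k ∷ rs) = (β k <ᵇ β c) ∨ isElder c rs

elderKids : List Tree → ℕ
elderKids [] = 0
elderKids (c ∷ cs) = (if isElder c cs then 1 else 0) + elderKids cs

improperKids : ℕ → List Tree → ℕ
improperKids v [] = 0
improperKids v (c ∷ cs) =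
  (if isElder c cs ∨ (v <ᵇ β c) then 0 else 1) + improperKids v cs

mutual
  eldT : Tree → ℕ
  eldT (node v cs) = elderKids cs + eldTs cs

  eldTs : List Tree → ℕ
  eldTs [] = 0
  eldTs (c ∷ cs) = eldT c + eldTs cs

mutual
  impT : Tree → ℕ
  impT (node v cs) = improperKids v cs + impTs cs

  impTs : List Tree → ℕ
  impTs [] = 0
  impTs (c ∷ cs) = impT c + impTs cs

-- Forests of r plane trees on [n] with roots 1..r.
-- A forest is listed as its trees ordered by root: the i-th tree has root i.

Forest : Set
Forest = List Tree

eld : Forest → ℕ
eld = eldTs

improper : Forest → ℕ
improper = impTs

-- roots are exactly 1,…,r and the vertex sets partition [n]
-- (the multiset of all labels, sorted, is 1,2,…,n)
IsForest : ℕ → ℕ → Forest → Set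
IsForest n r F =
  (map root F ≡ applyUpTo suc r) × (sort (labelsF F) ≡ applyUpTo suc n)

ForestsWith : ℕ → ℕ → ℕ → ℕ → Set
ForestsWith n r k j =
  Σ Forest (λ F → IsForest n r F × improper F ≡ k × eld F ≡ j)

{-# OPTIONS --safe #-}
module Submission where

-- The vertex N = n + 1 is deleted from a forest on [N].  A leaf N is either a last child
-- (n ways to put it back) or stands immediately to the left of a sibling (n − r ways, one elder
-- vertex more).  If N has one child, N subdivides an edge (n − r ways, one improper edge more).
-- If N has at least two children, let a, b be the last two.  The one of them with the larger β is
-- called i, the other c.  Then N is contracted into i, whose children become those of N left
-- of a and b, then c, then the old children of i; this makes (i , c) an improper edge, and every
-- improper edge arises once for each of the two orders of {a , b}.  When i comes first it is one
-- elder vertex more, when it comes last (N , i) is one improper edge more.  The numbers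
-- f(n , k , j) of forests thus satisfy
--   f(n+1 , k , j) = n f(n , k , j) + (n−r+k) f(n , k , j−1) + (n−r+k−1) f(n , k−1 , j),
-- and r Q_{n−r,k}(r , t) satisfies the same recurrence.  It also holds at
-- n = r, where the only forest consists of r isolated roots.

open import Defs
open import Data.Bool using (Bool; true; false; if_then_else_; _∧_; _∨_)
open import Data.Bool.Properties using (∨-assoc; ∨-comm; ∨-zeroʳ; ∨-identityʳ; ∧-zeroʳ; T-≡)
open import Data.Empty using (⊥-elim)
open import Data.Fin using (Fin) renaming (zero to fzero; suc to fsuc)
open import Data.Fin.Properties using (+↔⊎; *↔×)
open import Data.List using (List; []; _∷_; _++_; map; applyUpTo; length)
open import Data.List.Properties
  using (++-identityʳ; length-++; length-applyUpTo; applyUpTo-∷ʳ; map-∘; map-id)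
open import Data.List.Membership.Propositional using (_∈_; _∉_)
open import Data.List.Membership.Propositional.Properties
  using (∈-++⁻; ∈-++⁺ˡ; ∈-++⁺ʳ; ∈-applyUpTo⁺)
open import Data.List.Relation.Binary.Permutation.Propositional
  using (_↭_; ↭-refl; ↭-sym; ↭-trans; ↭-reflexive; prep; swap; ↭⇒↭ₛ)
open import Data.List.Relation.Binary.Permutation.Propositional.Properties
  using (shift; shifts; ++⁺ˡ; ++⁺ʳ; ++-comm; ∈-resp-↭; All-resp-↭; ↭-length; drop-∷; ↭-empty-inv)
import Data.List.Relation.Binary.Permutation.Setoid.Properties as Permₛ
open import Data.List.Relation.Binary.Pointwise using (Pointwise-≡⇒≡)
open import Data.List.Relation.Unary.All as All using (All; []; _∷_)
import Data.List.Relation.Unary.All.Properties as Allₚ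
open import Data.List.Relation.Unary.AllPairs using ([]; _∷_)
open import Data.List.Relation.Unary.Any using (here; there)
import Data.List.Relation.Unary.Sorted.TotalOrder.Properties as Sortedₚ
open import Data.List.Relation.Unary.Unique.Propositional using (Unique)
import Data.List.Relation.Unary.Unique.Propositional.Properties as Uniqueₚ
open import Data.Nat
  using (ℕ; zero; suc; _+_; _*_; _∸_; _^_; _≤_; _<_; _<ᵇ_; _≡ᵇ_; _⊓_; s≤s)
open import Data.Nat.Properties
open import Data.List.Sort ≤-decTotalOrder using (sort; sort-↭; sort-↗)
open import Data.Nat.Tactic.RingSolver using (solve-∀)
open import Data.Product using (Σ; ∃; ∃₂; _×_; _,_; proj₁; proj₂)
open import Data.Product.Function.Dependent.Propositional using (Σ-↔)
open import Data.Product.Function.NonDependent.Propositional using (_×-↔_)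
open import Data.Sum using (_⊎_; inj₁; inj₂)
open import Data.Sum.Function.Propositional using (_⊎-↔_)
open import Data.Unit using (tt)
open import Function using (_∘_; id)
open import Function.Bundles using (_↔_; mk↔ₛ′; Equivalence)
open import Function.Properties.Inverse using (↔-refl; ↔-sym; ↔-trans)
open import Algebra.Properties.CommutativeSemigroup +-commutativeSemigroup
  using (interchange; x∙yz≈y∙xz)
open import Algebra.Properties.CommutativeSemigroup *-commutativeSemigroup
  using () renaming (x∙yz≈y∙xz to x*yz≡y*xz)
open import Axiom.UniquenessOfIdentityProofs.WithK using (uip)
open import Relation.Binary.PropositionalEquality
open import Relation.Nullary using (¬_; yes; no; contradiction)

-- Smallest descendants, and properness as a comparison of minima

<ᵇ-true : ∀ {m n} → m < n → (m <ᵇ n) ≡ true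
<ᵇ-true = Equivalence.to T-≡ ∘ <⇒<ᵇ

<ᵇ-false : ∀ {m n} → n ≤ m → (m <ᵇ n) ≡ false
<ᵇ-false {m} {n} n≤m with m <ᵇ n in eq
... | false = refl
... | true  with () ← ≤⇒≯ n≤m (<ᵇ⇒< m n (Equivalence.from T-≡ eq))

⊓-<ᵇ : ∀ a b x → (a <ᵇ x) ∨ (b <ᵇ x) ≡ (a ⊓ b <ᵇ x)
⊓-<ᵇ zero    b       zero    = refl
⊓-<ᵇ zero    b       (suc x) = refl
⊓-<ᵇ (suc a) zero    zero    = refl
⊓-<ᵇ (suc a) zero    (suc x) = ∨-zeroʳ _
⊓-<ᵇ (suc a) (suc b) zero    = refl
⊓-<ᵇ (suc a) (suc b) (suc x) = ⊓-<ᵇ a b x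

minKids-⊓ : ∀ a b cs → minKids (a ⊓ b) cs ≡ a ⊓ minKids b cs
minKids-⊓ a b []       = refl
minKids-⊓ a b (c ∷ cs) =
  trans (cong (λ m → minKids m cs) (⊓-assoc a b (β c))) (minKids-⊓ a (b ⊓ β c) cs)

minKids-≤ : ∀ m cs → minKids m cs ≤ m
minKids-≤ m []       = ≤-refl
minKids-≤ m (c ∷ cs) = ≤-trans (minKids-≤ (m ⊓ β c) cs) (m⊓n≤m m (β c))

β<bound : ∀ {N} c → All (_< N) (labels c) → β c < N
β<bound (node v cs) (v<N ∷ _) = ≤-<-trans (minKids-≤ v cs) v<N

-- Both ways for an edge `(v , c)` to be proper say that some number is below `β c`: the label `v`,
-- or the β of a sibling in `cs`, which stands right of `c`. Together they compare `β c` with the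
-- minimum of these numbers.
elder-or-below : ∀ c v cs → isElder c cs ∨ (v <ᵇ β c) ≡ (minKids v cs <ᵇ β c)
elder-or-below c v []       = refl
elder-or-below c v (k ∷ cs) = begin
  ((β k <ᵇ β c) ∨ isElder c cs) ∨ (v <ᵇ β c)
    ≡⟨ cong (_∨ (v <ᵇ β c)) (∨-comm (β k <ᵇ β c) (isElder c cs)) ⟩
  (isElder c cs ∨ (β k <ᵇ β c)) ∨ (v <ᵇ β c)
    ≡⟨ ∨-assoc (isElder c cs) _ _ ⟩
  isElder c cs ∨ ((β k <ᵇ β c) ∨ (v <ᵇ β c))
    ≡⟨ cong (isElder c cs ∨_) (trans (∨-comm (β k <ᵇ β c) _) (⊓-<ᵇ v (β k) (β c))) ⟩
  isElder c cs ∨ (v ⊓ β k <ᵇ β c)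
    ≡⟨ elder-or-below c (v ⊓ β k) cs ⟩
  (minKids (v ⊓ β k) cs <ᵇ β c) ∎
  where open ≡-Reasoning

-- A starting value that is at least `β c` can never be what lies below `β c`, so the minimum tests
-- the siblings alone. This is applied with `v` a parent label or the new label `N`.
isElder-minKids : ∀ c v cs → β c ≤ v → isElder c cs ≡ (minKids v cs <ᵇ β c)
isElder-minKids c v cs βc≤v = begin
  isElder c cs                ≡⟨ ∨-identityʳ _ ⟨
  isElder c cs ∨ false        ≡⟨ cong (isElder c cs ∨_) (<ᵇ-false βc≤v) ⟨
  isElder c cs ∨ (v <ᵇ β c)   ≡⟨ elder-or-below c v cs ⟩
  (minKids v cs <ᵇ β c)       ∎
  where open ≡-Reasoning

isElder-β : ∀ {c c′} es → β c ≡ β c′ → isElder c es ≡ isElder c′ es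
isElder-β []       eq = refl
isElder-β (k ∷ es) eq = cong₂ (λ x b → (β k <ᵇ x) ∨ b) eq (isElder-β es eq)

one-unless one-if : Bool → ℕ
one-unless b = if b then 0 else 1
one-if     b = if b then 1 else 0

-- Bookkeeping for passing a sibling on the left: `u` is its own contribution, `c` that of its
-- subtree, and `g` the gain made further right.
add-sibling : ∀ u c g a b a′ b′ → a′ + b′ ≡ g + (a + b) →
              (u + a′) + (c + b′) ≡ g + ((u + a) + (c + b))
add-sibling u c g a b a′ b′ eq =
  trans (interchange u a′ c b′) (trans (cong ((u + c) +_) eq) (regroup u g a c b))
  where
  regroup : ∀ u g a c b → (u + c) + (g + (a + b)) ≡ g + ((u + a) + (c + b))
  regroup = solve-∀

push-gain : ∀ a g b c → a + ((g + b) + c) ≡ g + (a + (b + c))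
push-gain = solve-∀

-- The ways to insert a new largest vertex

data Kind : Set where
  plain elder impr : Kind

improperGain elderGain : Kind → ℕ
improperGain impr = 1
improperGain _    = 0
elderGain elder = 1
elderGain _     = 0

-- An improper edge (i , c) is precisely one with  β c < min(i , β of the siblings right of c).
-- Pulling it apart moves those siblings below a copy of i, and c next to that copy.
-- Labels are distinct, so < and ≤ agree; with one of each, undoing is total and unambiguous
-- for arbitrary labels.
data Pull (i : ℕ) (c : Tree) (rest : List Tree) : Kind → List Tree → Set where
  elderCopy : β c < minKids i rest → Pull i c rest elder (node i rest ∷ c ∷ [])
  lastCopy  : β c ≤ minKids i rest → Pull i c rest impr (c ∷ node i rest ∷ [])

-- `cs` are the children of `i` before the insertion, `ds` those of the new vertex that takes the
-- place of `i`. Children left of the pulled one pass unchanged to the new vertex. Read backwards,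
-- this is the contraction that deletes the new vertex.
data Merge (i : ℕ) : Kind → List Tree → List Tree → Set where
  here : ∀ {k c rest ds} → Pull i c rest k ds → Merge i k (c ∷ rest) ds
  skip : ∀ {k c cs ds} → Merge i k cs ds → Merge i k (c ∷ cs) (c ∷ ds)

module Insertion (N : ℕ) where

  -- The new vertex becomes the first entry of the new list. As `last` asks for an empty list, a
  -- last leaf arises in one way only, by passing all siblings with `later`.
  data Top : Kind → List Tree → List Tree → Set where
    last   : Top plain [] (node N [] ∷ [])
    before : ∀ {c cs} → Top elder (c ∷ cs) (node N [] ∷ c ∷ cs)
    split  : ∀ {c cs} → Top impr (c ∷ cs) (node N (c ∷ []) ∷ cs)
    merge  : ∀ {k i cs ds es} → Merge i k cs ds → Top k (node i cs ∷ es) (node N ds ∷ es)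

  data Ins : Kind → List Tree → List Tree → Set where
    top    : ∀ {k cs cs′} → Top k cs cs′ → Ins k cs cs′
    inside : ∀ {k v cs cs′ es} → Ins k cs cs′ → Ins k (node v cs ∷ es) (node v cs′ ∷ es)
    later  : ∀ {k c es es′} → Ins k es es′ → Ins k (c ∷ es) (c ∷ es′)

  -- The roots are fixed, so the outermost level has no counterpart of `top`.
  data InsF : Kind → Forest → Forest → Set where
    inside : ∀ {k v cs cs′ es} → Ins k cs cs′ → InsF k (node v cs ∷ es) (node v cs′ ∷ es)
    later  : ∀ {k c es es′} → InsF k es es′ → InsF k (c ∷ es) (c ∷ es′)

  -- Effect on labels and roots

  merge-labels : ∀ {i k cs ds} → Merge i k cs ds → labelsF ds ↭ i ∷ labelsF cs
  merge-labels {i} {cs = c ∷ rest} (here (elderCopy _)) = prep i (↭-trans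
    (++-comm (labelsF rest) (labels c ++ []))
    (↭-reflexive (cong (_++ labelsF rest) (++-identityʳ (labels c)))))
  merge-labels {i} {cs = c ∷ rest} (here (lastCopy _)) = ↭-trans
    (↭-reflexive (cong (λ xs → labels c ++ i ∷ xs) (++-identityʳ (labelsF rest))))
    (shift i (labels c) (labelsF rest))
  merge-labels {i} {cs = c ∷ cs} (skip m) =
    ↭-trans (++⁺ˡ (labels c) (merge-labels m)) (shift i (labels c) (labelsF cs))

  top-labels : ∀ {k es es′} → Top k es es′ → labelsF es′ ↭ N ∷ labelsF es
  top-labels last   = ↭-refl
  top-labels before = ↭-refl
  top-labels (split {c} {cs}) =
    ↭-reflexive (cong (λ xs → N ∷ xs ++ labelsF cs) (++-identityʳ (labels c)))
  top-labels (merge {es = es} m) = prep N (++⁺ʳ (labelsF es) (merge-labels m))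

  ins-labels : ∀ {k es es′} → Ins k es es′ → labelsF es′ ↭ N ∷ labelsF es
  ins-labels (top t) = top-labels t
  ins-labels (inside {v = v} {es = es} x) =
    ↭-trans (prep v (++⁺ʳ (labelsF es) (ins-labels x))) (swap v N ↭-refl)
  ins-labels (later {c = c} {es} x) =
    ↭-trans (++⁺ˡ (labels c) (ins-labels x)) (shift N (labels c) (labelsF es))

  insF-labels : ∀ {k F F′} → InsF k F F′ → labelsF F′ ↭ N ∷ labelsF F
  insF-labels (inside {v = v} {es = es} x) =
    ↭-trans (prep v (++⁺ʳ (labelsF es) (ins-labels x))) (swap v N ↭-refl)
  insF-labels (later {c = c} {es} x) =
    ↭-trans (++⁺ˡ (labels c) (insF-labels x)) (shift N (labels c) (labelsF es))

  insF-roots : ∀ {k F F′} → InsF k F F′ → map root F′ ≡ map root F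
  insF-roots (inside _)        = refl
  insF-roots (later {c = c} x) = cong (root c ∷_) (insF-roots x)

  -- Smallest descendants are preserved

  merge-minKids : ∀ {i k cs ds} m → Merge i k cs ds → minKids m ds ≡ m ⊓ minKids i cs
  merge-minKids {i} {cs = c ∷ rest} m (here (elderCopy _)) = trans
    (⊓-assoc m (minKids i rest) (β c))
    (cong (m ⊓_) (trans (⊓-comm _ (β c)) (trans (sym (minKids-⊓ (β c) i rest))
      (cong (λ x → minKids x rest) (⊓-comm (β c) i)))))
  merge-minKids {i} {cs = c ∷ rest} m (here (lastCopy _)) = trans
    (⊓-assoc m (β c) (minKids i rest))
    (cong (m ⊓_) (trans (sym (minKids-⊓ (β c) i rest))
      (cong (λ x → minKids x rest) (⊓-comm (β c) i))))
  merge-minKids {i} {cs = c ∷ cs} m (skip x) = trans (merge-minKids (m ⊓ β c) x) (trans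
    (⊓-assoc m (β c) (minKids i cs))
    (cong (m ⊓_) (trans (sym (minKids-⊓ (β c) i cs))
      (cong (λ x → minKids x cs) (⊓-comm (β c) i)))))

  -- The trees in `ds` carry the label `i` and the labels in `cs`, only arranged differently, and
  -- `N` exceeds `i`. Hence the vertex `N` with children `ds` has the same β as `i` had.
  merge-β : ∀ {i k cs ds} → i < N → Merge i k cs ds → minKids N ds ≡ minKids i cs
  merge-β {i} {cs = cs} i<N x = trans (merge-minKids N x)
    (m≥n⇒m⊓n≡n (≤-trans (minKids-≤ i cs) (<⇒≤ i<N)))

  -- A leaf contributes only `N`, which `m ≤ N` hides from the minimum; in the other cases the tree
  -- that is replaced keeps its β.
  top-minKids : ∀ {k es es′} m → m ≤ N → All (_< N) (labelsF es) → Top k es es′ →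
                minKids m es′ ≡ minKids m es
  top-minKids m m≤N bd last = m≤n⇒m⊓n≡m m≤N
  top-minKids m m≤N bd (before {c} {cs}) =
    cong (λ x → minKids (x ⊓ β c) cs) (m≤n⇒m⊓n≡m m≤N)
  top-minKids m m≤N bd (split {c} {cs}) = cong (λ x → minKids (m ⊓ x) cs)
    (m≥n⇒m⊓n≡n (<⇒≤ (β<bound c (Allₚ.++⁻ˡ (labels c) bd))))
  top-minKids m m≤N (i<N ∷ _) (merge {es = es} x) =
    cong (λ y → minKids (m ⊓ y) es) (merge-β i<N x)

  ins-minKids : ∀ {k es es′} m → m ≤ N → All (_< N) (labelsF es) → Ins k es es′ →
                minKids m es′ ≡ minKids m es
  ins-minKids m m≤N bd (top t) = top-minKids m m≤N bd t
  ins-minKids m m≤N (v<N ∷ bd) (inside {v = v} {cs} {es = es} x) =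
    cong (λ y → minKids (m ⊓ y) es) (ins-minKids v (<⇒≤ v<N) (Allₚ.++⁻ˡ (labelsF cs) bd) x)
  ins-minKids m m≤N bd (later {c = c} x) =
    ins-minKids (m ⊓ β c) (≤-trans (m⊓n≤m m _) m≤N) (Allₚ.++⁻ʳ (labels c) bd) x

  -- Change in the numbers of elder vertices and improper edges

  isElder-cong : ∀ c es es′ → β c < N → minKids N es′ ≡ minKids N es →
                 isElder c es′ ≡ isElder c es
  isElder-cong c es es′ βc<N eq = begin
    isElder c es′            ≡⟨ isElder-minKids c N es′ (<⇒≤ βc<N) ⟩
    (minKids N es′ <ᵇ β c)   ≡⟨ cong (_<ᵇ β c) eq ⟩
    (minKids N es <ᵇ β c)    ≡⟨ isElder-minKids c N es (<⇒≤ βc<N) ⟨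
    isElder c es             ∎
    where open ≡-Reasoning

  pull-≤ : ∀ {i c rest k ds} → Pull i c rest k ds → β c ≤ minKids i rest
  pull-≤ (elderCopy lt) = <⇒≤ lt
  pull-≤ (lastCopy le)  = le

  -- The pulled child lies in `cs` and its β is at most `i`, so it hides any starting value from `i`
  -- upwards.
  merge-parent-irrelevant : ∀ {i k cs ds} m → i ≤ m → Merge i k cs ds →
                            minKids m cs ≡ minKids i cs
  merge-parent-irrelevant {i} {cs = c ∷ rest} m i≤m (here p) =
    cong (λ x → minKids x rest) (trans (m≥n⇒m⊓n≡n (≤-trans βc≤i i≤m)) (sym (m≥n⇒m⊓n≡n βc≤i)))
    where
    βc≤i : β c ≤ i
    βc≤i = ≤-trans (pull-≤ p) (minKids-≤ i rest)
  merge-parent-irrelevant {i} {cs = c ∷ cs} m i≤m (skip x) = begin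
    minKids (m ⊓ β c) cs     ≡⟨ cong (λ y → minKids y cs) (⊓-comm m (β c)) ⟩
    minKids (β c ⊓ m) cs     ≡⟨ minKids-⊓ (β c) m cs ⟩
    β c ⊓ minKids m cs       ≡⟨ cong (β c ⊓_) (merge-parent-irrelevant m i≤m x) ⟩
    β c ⊓ minKids i cs       ≡⟨ minKids-⊓ (β c) i cs ⟨
    minKids (β c ⊓ i) cs     ≡⟨ cong (λ y → minKids y cs) (⊓-comm (β c) i) ⟩
    minKids (i ⊓ β c) cs     ∎
    where open ≡-Reasoning

  -- Below `N` an edge is proper only if its child is elder. The improper edge `(i , c)` disappears.
  -- With `elderCopy` the copy of `i` is elder and only `(N , c)` is improper, so the number stays;
  -- with `lastCopy` neither child is elder and both edges are improper.
  merge-improper : ∀ {i k cs ds} → i < N → All (_< N) (labelsF cs) → Merge i k cs ds →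
    improperKids N ds + impTs ds ≡ improperGain k + (improperKids i cs + impTs cs)
  merge-improper {i} i<N bd (here {c = c} {rest} (elderCopy lt))
    rewrite elder-or-below c i rest
          | <ᵇ-false (<⇒≤ lt) | <ᵇ-true lt
          | <ᵇ-false (<⇒≤ (β<bound c (Allₚ.++⁻ˡ (labels c) bd)))
    = solved (improperKids i rest) (impTs rest) (impT c)
    where
    solved : ∀ a b c → 1 + ((a + b) + (c + 0)) ≡ (1 + a) + (c + b)
    solved = solve-∀
  merge-improper {i} i<N bd (here {c = c} {rest} (lastCopy le))
    rewrite elder-or-below c i rest
          | <ᵇ-false le
          | <ᵇ-false (<⇒≤ (β<bound c (Allₚ.++⁻ˡ (labels c) bd)))
          | <ᵇ-false (≤-trans (minKids-≤ i rest) (<⇒≤ i<N))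
    = solved (improperKids i rest) (impTs rest) (impT c)
    where
    solved : ∀ a b c → 2 + (c + ((a + b) + 0)) ≡ 1 + ((1 + a) + (c + b))
    solved = solve-∀
  merge-improper {i} {k} i<N bd (skip {c = c} {cs} {ds} x) = trans
    (cong (λ b → (one-unless b + improperKids N ds) + (impT c + impTs ds)) same)
    (add-sibling (one-unless (isElder c cs ∨ (i <ᵇ β c))) (impT c) (improperGain k)
      (improperKids i cs) (impTs cs) (improperKids N ds) (impTs ds)
      (merge-improper i<N (Allₚ.++⁻ʳ (labels c) bd) x))
    where
    -- A child left of the pulled one changes its parent from `i` to `N`, but the minimum that
    -- decides on properness is the same.
    same : isElder c ds ∨ (N <ᵇ β c) ≡ isElder c cs ∨ (i <ᵇ β c)
    same = trans (elder-or-below c N ds)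
      (trans (cong (_<ᵇ β c) (merge-β i<N x)) (sym (elder-or-below c i cs)))

  -- The pulled `c` is not elder, before or after, since no sibling right of it has a smaller β. The
  -- siblings moved below the copy keep their order. Only `elderCopy` creates an elder vertex, the
  -- copy itself.
  merge-elder : ∀ {i k cs ds} → i < N → All (_< N) (labelsF cs) → Merge i k cs ds →
    elderKids ds + eldTs ds ≡ elderGain k + (elderKids cs + eldTs cs)
  merge-elder {i} i<N bd (here {c = c} {rest} (elderCopy lt))
    rewrite isElder-minKids c i rest (<⇒≤ (<-≤-trans lt (minKids-≤ i rest)))
          | <ᵇ-false (<⇒≤ lt) | <ᵇ-true lt
    = solved (elderKids rest) (eldTs rest) (eldT c)
    where
    solved : ∀ a b c → 1 + ((a + b) + (c + 0)) ≡ 1 + (a + (c + b))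
    solved = solve-∀
  merge-elder {i} i<N bd (here {c = c} {rest} (lastCopy le))
    rewrite isElder-minKids c i rest (≤-trans le (minKids-≤ i rest))
          | <ᵇ-false le
    = solved (elderKids rest) (eldTs rest) (eldT c)
    where
    solved : ∀ a b c → c + ((a + b) + 0) ≡ a + (c + b)
    solved = solve-∀
  merge-elder {i} {k} i<N bd (skip {c = c} {cs} {ds} x) = trans
    (cong (λ b → (one-if b + elderKids ds) + (eldT c + eldTs ds)) same)
    (add-sibling (one-if (isElder c cs)) (eldT c) (elderGain k)
      (elderKids cs) (eldTs cs) (elderKids ds) (eldTs ds)
      (merge-elder i<N (Allₚ.++⁻ʳ (labels c) bd) x))
    where
    same : isElder c ds ≡ isElder c cs
    -- On the right of `c` the label `i` is now present as well; it cannot change the minimum, as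
    -- the pulled child has a β of at most `i`.
    same = isElder-cong c cs ds (β<bound c (Allₚ.++⁻ˡ (labels c) bd))
      (trans (merge-β i<N x) (sym (merge-parent-irrelevant N (<⇒≤ i<N) x)))

  improper-head : ∀ v c c′ es g → β c′ ≡ β c → impT c′ ≡ g + impT c →
    improperKids v (c′ ∷ es) + impTs (c′ ∷ es) ≡ g + (improperKids v (c ∷ es) + impTs (c ∷ es))
  improper-head v c c′ es g eqβ eq rewrite isElder-β {c′} {c} es eqβ | eqβ | eq =
    push-gain (improperKids v (c ∷ es)) g (impT c) (impTs es)

  elder-head : ∀ c c′ es g → β c′ ≡ β c → eldT c′ ≡ g + eldT c →
    elderKids (c′ ∷ es) + eldTs (c′ ∷ es) ≡ g + (elderKids (c ∷ es) + eldTs (c ∷ es))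
  elder-head c c′ es g eqβ eq rewrite isElder-β {c′} {c} es eqβ | eq =
    push-gain (elderKids (c ∷ es)) g (eldT c) (eldTs es)

  -- A leaf `N` hangs on a proper edge because `v < N`. In `split` the edge above `N` inherits the
  -- status of the old edge above `c`, and `(N , c)` is improper: `c` has no siblings there and
  -- `β c ≤ N`.
  top-improper : ∀ {k es es′ v} → v < N → All (_< N) (labelsF es) → Top k es es′ →
    improperKids v es′ + impTs es′ ≡ improperGain k + (improperKids v es + impTs es)
  top-improper {v = v} v<N bd last rewrite <ᵇ-true v<N = refl
  top-improper {v = v} v<N bd (before {c} {cs})
    rewrite <ᵇ-true v<N | ∨-zeroʳ (isElder (node N []) (c ∷ cs)) = refl
  top-improper {v = v} v<N bd (split {c} {cs}) =
    improper-head v c _ cs 1 (m≥n⇒m⊓n≡n βc≤N)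
      (cong₂ (λ b x → (one-unless b + 0) + x) (<ᵇ-false βc≤N) (+-identityʳ (impT c)))
    where
    βc≤N : β c ≤ N
    βc≤N = <⇒≤ (β<bound c (Allₚ.++⁻ˡ (labels c) bd))
  top-improper {k} {v = v} v<N (i<N ∷ bd) (merge {i = i} {cs} {es = es} x) =
    improper-head v (node i cs) _ es (improperGain k) (merge-β i<N x)
      (merge-improper i<N (Allₚ.++⁻ˡ (labelsF cs) bd) x)

  -- A leaf `N` is elder as soon as it has a sibling on its right, because all other labels are
  -- smaller.
  top-elder : ∀ {k es es′} → All (_< N) (labelsF es) → Top k es es′ →
    elderKids es′ + eldTs es′ ≡ elderGain k + (elderKids es + eldTs es)
  top-elder bd last = refl
  top-elder bd (before {c} {cs}) rewrite <ᵇ-true (β<bound c (Allₚ.++⁻ˡ (labels c) bd)) = refl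
  top-elder bd (split {c} {cs}) =
    elder-head c _ cs 0 (m≥n⇒m⊓n≡n (<⇒≤ (β<bound c (Allₚ.++⁻ˡ (labels c) bd))))
      (+-identityʳ (eldT c))
  top-elder {k} (i<N ∷ bd) (merge {i = i} {cs} {es = es} x) =
    elder-head (node i cs) _ es (elderGain k) (merge-β i<N x)
      (merge-elder i<N (Allₚ.++⁻ˡ (labelsF cs) bd) x)

  ins-improper : ∀ {k es es′ v} → v < N → All (_< N) (labelsF es) → Ins k es es′ →
    improperKids v es′ + impTs es′ ≡ improperGain k + (improperKids v es + impTs es)
  ins-improper v<N bd (top t) = top-improper v<N bd t
  ins-improper {k} {v = v} v<N (w<N ∷ bd) (inside {v = w} {cs} {es = es} x) =
    improper-head v (node w cs) _ es (improperGain k)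
      (ins-minKids w (<⇒≤ w<N) bd′ x) (ins-improper w<N bd′ x)
    where
    bd′ : All (_< N) (labelsF cs)
    bd′ = Allₚ.++⁻ˡ (labelsF cs) bd
  ins-improper {k} {v = v} v<N bd (later {c = c} {es} {es′} x) = trans
    (cong (λ b → (one-unless (b ∨ (v <ᵇ β c)) + improperKids v es′) + (impT c + impTs es′))
      (isElder-cong c es es′ (β<bound c (Allₚ.++⁻ˡ (labels c) bd)) (ins-minKids N ≤-refl bd′ x)))
    (add-sibling (one-unless (isElder c es ∨ (v <ᵇ β c))) (impT c) (improperGain k)
      (improperKids v es) (impTs es) (improperKids v es′) (impTs es′)
      (ins-improper v<N bd′ x))
    where
    bd′ : All (_< N) (labelsF es)
    bd′ = Allₚ.++⁻ʳ (labels c) bd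

  ins-elder : ∀ {k es es′} → All (_< N) (labelsF es) → Ins k es es′ →
    elderKids es′ + eldTs es′ ≡ elderGain k + (elderKids es + eldTs es)
  ins-elder bd (top t) = top-elder bd t
  ins-elder {k} (w<N ∷ bd) (inside {v = w} {cs} {es = es} x) =
    elder-head (node w cs) _ es (elderGain k)
      (ins-minKids w (<⇒≤ w<N) bd′ x) (ins-elder bd′ x)
    where
    bd′ : All (_< N) (labelsF cs)
    bd′ = Allₚ.++⁻ˡ (labelsF cs) bd
  ins-elder {k} bd (later {c = c} {es} {es′} x) = trans
    (cong (λ b → (one-if b + elderKids es′) + (eldT c + eldTs es′))
      (isElder-cong c es es′ (β<bound c (Allₚ.++⁻ˡ (labels c) bd)) (ins-minKids N ≤-refl bd′ x)))
    (add-sibling (one-if (isElder c es)) (eldT c) (elderGain k)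
      (elderKids es) (eldTs es) (elderKids es′) (eldTs es′)
      (ins-elder bd′ x))
    where
    bd′ : All (_< N) (labelsF es)
    bd′ = Allₚ.++⁻ʳ (labels c) bd

  insF-improper : ∀ {k F F′} → All (_< N) (labelsF F) → InsF k F F′ →
                  improper F′ ≡ improperGain k + improper F
  insF-improper {k} (v<N ∷ bd) (inside {cs = cs} {es = es} x) = trans
    (cong (_+ impTs es) (ins-improper v<N (Allₚ.++⁻ˡ (labelsF cs) bd) x))
    (+-assoc (improperGain k) _ _)
  insF-improper {k} bd (later {c = c} x) = trans
    (cong (impT c +_) (insF-improper (Allₚ.++⁻ʳ (labels c) bd) x))
    (x∙yz≈y∙xz (impT c) (improperGain k) _)

  insF-elder : ∀ {k F F′} → All (_< N) (labelsF F) → InsF k F F′ →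
               eld F′ ≡ elderGain k + eld F
  insF-elder {k} (v<N ∷ bd) (inside {cs = cs} {es = es} x) = trans
    (cong (_+ eldTs es) (ins-elder (Allₚ.++⁻ˡ (labelsF cs) bd) x))
    (+-assoc (elderGain k) _ _)
  insF-elder {k} bd (later {c = c} x) = trans
    (cong (eldT c +_) (insF-elder (Allₚ.++⁻ʳ (labels c) bd) x))
    (x∙yz≈y∙xz (eldT c) (elderGain k) _)

-- Distinct labels, and bijections with `Fin`

Unique-resp-↭ : {xs ys : List ℕ} → xs ↭ ys → Unique xs → Unique ys
Unique-resp-↭ p = Permₛ.Unique-resp-↭ (setoid ℕ) (↭⇒↭ₛ p)

Unique-++⁻ˡ : ∀ (xs : List ℕ) {ys} → Unique (xs ++ ys) → Unique xs
Unique-++⁻ˡ []       u         = []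
Unique-++⁻ˡ (x ∷ xs) (x∉ ∷ u) = Allₚ.++⁻ˡ xs x∉ ∷ Unique-++⁻ˡ xs u

Unique-++⁻ʳ : ∀ (xs : List ℕ) {ys} → Unique (xs ++ ys) → Unique ys
Unique-++⁻ʳ []       u        = u
Unique-++⁻ʳ (x ∷ xs) (_ ∷ u) = Unique-++⁻ʳ xs u

Unique-++-≢ : ∀ (xs : List ℕ) {ys x y} → Unique (xs ++ ys) → x ∈ xs → y ∈ ys → x ≢ y
Unique-++-≢ (_ ∷ xs) (x∉ ∷ _) (here refl) y∈ = All.lookup x∉ (∈-++⁺ʳ xs y∈)
Unique-++-≢ (_ ∷ xs) (_ ∷ u)  (there x∈)  y∈ = Unique-++-≢ xs u x∈ y∈

mutual
  β∈labels : ∀ c → β c ∈ labels c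
  β∈labels (node v cs) = minKids∈ v cs

  minKids∈ : ∀ m cs → minKids m cs ∈ m ∷ labelsF cs
  minKids∈ m []       = here refl
  minKids∈ m (c ∷ cs) with minKids∈ (m ⊓ β c) cs
  ... | there ∈cs = there (∈-++⁺ʳ (labels c) ∈cs)
  ... | here eq with ⊓-sel m (β c)
  ...   | inj₁ m⊓≡m = here (trans eq m⊓≡m)
  ...   | inj₂ m⊓≡β = there (∈-++⁺ˡ (subst (_∈ labels c) (sym (trans eq m⊓≡β)) (β∈labels c)))

Fin0↔ : {A : Set} → ¬ A → A ↔ Fin 0
Fin0↔ ¬a = mk↔ₛ′ (⊥-elim ∘ ¬a) (λ ()) (λ ()) (⊥-elim ∘ ¬a)

Fin1↔ : {A : Set} (a : A) → (∀ b → a ≡ b) → A ↔ Fin 1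
Fin1↔ a contr = mk↔ₛ′ (λ _ → fzero) (λ _ → a) (λ { fzero → refl ; (fsuc ()) }) contr

Fin+↔ : {A B : Set} {m n : ℕ} → A ↔ Fin m → B ↔ Fin n → (A ⊎ B) ↔ Fin (m + n)
Fin+↔ f g = ↔-trans (f ⊎-↔ g) (↔-sym +↔⊎)

-- Every insertion can be undone in exactly one way

merge-not-plain : ∀ {i cs ds} → ¬ Merge i plain cs ds
merge-not-plain (skip m) = merge-not-plain m

-- Only the last two children matter: if the right one has the smaller β, the left one is the copy
-- of `i`, otherwise the right one is. Earlier children are passed by `skip`.
unmerge : ∀ a b ds → ∃ λ i → ∃₂ λ k cs → Merge i k cs (a ∷ b ∷ ds)
unmerge a@(node i rest) b@(node j rest′) [] with β b <? β a
... | yes b<a = i , elder , b ∷ rest , here (elderCopy b<a)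
... | no  b≮a = j , impr , a ∷ rest′ , here (lastCopy (≮⇒≥ b≮a))
unmerge a b (d ∷ ds) with unmerge b d ds
... | i , k , cs , m = i , k , a ∷ cs , skip m

merge-≢[] : ∀ {i k cs} → ¬ Merge i k cs []
merge-≢[] (here ())

merge-≢[-] : ∀ {i k cs d} → ¬ Merge i k cs (d ∷ [])
merge-≢[-] (here ())
merge-≢[-] (skip x) = merge-≢[] x

-- `here` leaves exactly two entries and `skip` at least three, and `<` excludes the reverse `≤`, so
-- `ds` fixes the constructors. Comparing whole tuples lets one match on `refl` identify the indices
-- too.
merge-unique : ∀ {i₁ i₂ k₁ k₂ cs₁ cs₂ ds} (x : Merge i₁ k₁ cs₁ ds) (y : Merge i₂ k₂ cs₂ ds) →
  _≡_ {A = ∃ λ i → ∃₂ λ k cs → Merge i k cs ds} (i₁ , k₁ , cs₁ , x) (i₂ , k₂ , cs₂ , y)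
merge-unique (here (elderCopy p)) (here (elderCopy q))
  rewrite <-irrelevant p q = refl
merge-unique (here (elderCopy p)) (here (lastCopy q)) = contradiction q (<⇒≱ p)
merge-unique (here (lastCopy p)) (here (elderCopy q)) = contradiction p (<⇒≱ q)
merge-unique (here (lastCopy p)) (here (lastCopy q))
  rewrite ≤-irrelevant p q = refl
merge-unique (here (elderCopy _)) (skip y) = contradiction y merge-≢[-]
merge-unique (here (lastCopy _))  (skip y) = contradiction y merge-≢[-]
merge-unique (skip x) (here (elderCopy _)) = contradiction x merge-≢[-]
merge-unique (skip x) (here (lastCopy _))  = contradiction x merge-≢[-]
merge-unique (skip x) (skip y) with refl ← merge-unique x y = refl

module Removal (N : ℕ) where
  open Insertion N

  top-exists : ∀ cs es → ∃₂ λ k es₀ → Top k es₀ (node N cs ∷ es)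
  -- The number of children of `N` decides (none, one, or at least two); for a leaf, so does the
  -- presence of a sibling on its right.
  top-exists []           []       = plain , _ , last
  top-exists []           (e ∷ es) = elder , _ , before
  top-exists (c ∷ [])     es       = impr , _ , split
  top-exists (a ∷ b ∷ cs) es       with unmerge a b cs
  ... | i , k , ds , m = k , _ , merge m

  ins-exists : ∀ es′ → N ∈ labelsF es′ → ∃₂ λ k es → Ins k es es′
  ins-exists (node v cs ∷ es) N∈ with v ≟ N
  ... | yes refl with k , _ , t ← top-exists cs es = k , _ , top t
  ins-exists (node v cs ∷ es) (here N≡v) | no v≢N = contradiction (sym N≡v) v≢N
  ins-exists (node v cs ∷ es) (there N∈) | no v≢N with ∈-++⁻ (labelsF cs) N∈
  ... | inj₁ N∈cs with k , _ , x ← ins-exists cs N∈cs = k , _ , inside x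
  ... | inj₂ N∈es with k , _ , x ← ins-exists es N∈es = k , _ , later x

  insF-exists : ∀ F′ → N ∉ map root F′ → N ∈ labelsF F′ → ∃₂ λ k F → InsF k F F′
  insF-exists (node v cs ∷ es) N∉ (here N≡v) = contradiction (here N≡v) N∉
  insF-exists (node v cs ∷ es) N∉ (there N∈) with ∈-++⁻ (labelsF cs) N∈
  ... | inj₁ N∈cs with k , _ , x ← ins-exists cs N∈cs = k , _ , inside x
  ... | inj₂ N∈es with k , _ , x ← insF-exists es (N∉ ∘ there) N∈es = k , _ , later x

  ∈-ins : ∀ {k es es′} → Ins k es es′ → N ∈ labelsF es′
  ∈-ins x = ∈-resp-↭ (↭-sym (ins-labels x)) (here refl)

  top-root : ∀ {k es v cs es′} → Top k es (node v cs ∷ es′) → N ≡ v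
  top-root last      = refl
  top-root before    = refl
  top-root split     = refl
  top-root (merge _) = refl

  top-unique : ∀ {k₁ k₂ es₁ es₂ es′} (x : Top k₁ es₁ es′) (y : Top k₂ es₂ es′) →
    _≡_ {A = ∃₂ λ k es → Top k es es′} (k₁ , es₁ , x) (k₂ , es₂ , y)
  top-unique last      last      = refl
  top-unique before    before    = refl
  top-unique split     split     = refl
  top-unique last      (merge y) = contradiction y merge-≢[]
  top-unique before    (merge y) = contradiction y merge-≢[]
  top-unique split     (merge y) = contradiction y merge-≢[-]
  top-unique (merge x) last      = contradiction x merge-≢[]
  top-unique (merge x) before    = contradiction x merge-≢[]
  top-unique (merge x) split     = contradiction x merge-≢[-]
  top-unique (merge x) (merge y) with refl ← merge-unique x y = refl

  -- `N` is absent before the insertion. If two insertions with the same result placed it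
  -- differently, one of the original lists would already contain it.
  ins-unique : ∀ {k₁ k₂ es₁ es₂ es′} → N ∉ labelsF es₁ → N ∉ labelsF es₂ →
    (x : Ins k₁ es₁ es′) (y : Ins k₂ es₂ es′) →
    _≡_ {A = ∃₂ λ k es → Ins k es es′} (k₁ , es₁ , x) (k₂ , es₂ , y)
  ins-unique N∉₁ N∉₂ (top x) (top y) with refl ← top-unique x y = refl
  ins-unique N∉₁ N∉₂ (top x) (inside y) = contradiction (here (top-root x)) N∉₂
  ins-unique N∉₁ N∉₂ (inside x) (top y) = contradiction (here (top-root y)) N∉₁
  ins-unique N∉₁ N∉₂ (top x) (later {c = node _ _} y) = contradiction (here (top-root x)) N∉₂
  ins-unique N∉₁ N∉₂ (later {c = node _ _} x) (top y) = contradiction (here (top-root y)) N∉₁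
  ins-unique N∉₁ N∉₂ (inside x) (later y) = contradiction (there (∈-++⁺ˡ (∈-ins x))) N∉₂
  ins-unique N∉₁ N∉₂ (later x) (inside y) = contradiction (there (∈-++⁺ˡ (∈-ins y))) N∉₁
  ins-unique N∉₁ N∉₂ (inside x) (inside y)
    with refl ← ins-unique (N∉₁ ∘ there ∘ ∈-++⁺ˡ) (N∉₂ ∘ there ∘ ∈-++⁺ˡ) x y = refl
  ins-unique N∉₁ N∉₂ (later {c = c} x) (later y)
    with refl ← ins-unique (N∉₁ ∘ ∈-++⁺ʳ (labels c)) (N∉₂ ∘ ∈-++⁺ʳ (labels c)) x y = refl

  insF-unique : ∀ {k₁ k₂ F₁ F₂ F′} → N ∉ labelsF F₁ → N ∉ labelsF F₂ →
    (x : InsF k₁ F₁ F′) (y : InsF k₂ F₂ F′) →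
    _≡_ {A = ∃₂ λ k F → InsF k F F′} (k₁ , F₁ , x) (k₂ , F₂ , y)
  insF-unique N∉₁ N∉₂ (inside x) (later y) = contradiction (there (∈-++⁺ˡ (∈-ins x))) N∉₂
  insF-unique N∉₁ N∉₂ (later x) (inside y) = contradiction (there (∈-++⁺ˡ (∈-ins y))) N∉₁
  insF-unique N∉₁ N∉₂ (inside x) (inside y)
    with refl ← ins-unique (N∉₁ ∘ there ∘ ∈-++⁺ˡ) (N∉₂ ∘ there ∘ ∈-++⁺ˡ) x y = refl
  insF-unique N∉₁ N∉₂ (later {c = c} x) (later y)
    with refl ← insF-unique (N∉₁ ∘ ∈-++⁺ʳ (labels c)) (N∉₂ ∘ ∈-++⁺ʳ (labels c)) x y = refl

-- Counting the insertions into a given forest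

β-distinct : ∀ i c rest → Unique (i ∷ labels c ++ labelsF rest) → β c ≢ minKids i rest
β-distinct i c rest u = Unique-++-≢ (labels c)
  (Unique-resp-↭ (↭-sym (shift i (labels c) (labelsF rest))) u) (β∈labels c) (minKids∈ i rest)

-- Improperness of `(i , c)` is a weak inequality of minima, `elderCopy` a strict one; distinct
-- labels rule out equality, so an improper edge can be pulled apart in exactly one way of this
-- kind.
count-pull-elder : ∀ i c rest → Unique (i ∷ labels c ++ labelsF rest) →
  ∃ (Pull i c rest elder) ↔ Fin (one-unless (isElder c rest ∨ (i <ᵇ β c)))
count-pull-elder i c rest u rewrite elder-or-below c i rest with β c <? minKids i rest
... | yes lt rewrite <ᵇ-false (<⇒≤ lt) =
  Fin1↔ (_ , elderCopy lt)
    λ { (_ , elderCopy lt′) → cong (λ p → _ , elderCopy p) (<-irrelevant lt lt′) }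
... | no ≮ rewrite <ᵇ-true (≤∧≢⇒< (≮⇒≥ ≮) (≢-sym (β-distinct i c rest u))) =
  Fin0↔ λ { (_ , elderCopy lt) → ≮ lt }

count-pull-impr : ∀ i c rest → Unique (i ∷ labels c ++ labelsF rest) →
  ∃ (Pull i c rest impr) ↔ Fin (one-unless (isElder c rest ∨ (i <ᵇ β c)))
count-pull-impr i c rest u rewrite elder-or-below c i rest with β c ≤? minKids i rest
... | yes le rewrite <ᵇ-false le =
  Fin1↔ (_ , lastCopy le)
    λ { (_ , lastCopy le′) → cong (λ p → _ , lastCopy p) (≤-irrelevant le le′) }
... | no ≰ rewrite <ᵇ-true (≰⇒> ≰) =
  Fin0↔ λ { (_ , lastCopy le) → ≰ le }

count-merge : ∀ k i → (∀ c rest → Unique (i ∷ labels c ++ labelsF rest) →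
                 ∃ (Pull i c rest k) ↔ Fin (one-unless (isElder c rest ∨ (i <ᵇ β c)))) →
  ∀ cs → Unique (i ∷ labelsF cs) → ∃ (Merge i k cs) ↔ Fin (improperKids i cs)
count-merge k i pulls []       u          = Fin0↔ λ ()
count-merge k i pulls (c ∷ cs) u@(i∉ ∷ u′) = ↔-trans
  (mk↔ₛ′ (λ { (_ , here p) → inj₁ (_ , p) ; (_ , skip x) → inj₂ (_ , x) })
         (λ { (inj₁ (_ , p)) → _ , here p ; (inj₂ (_ , x)) → _ , skip x })
         (λ { (inj₁ _) → refl ; (inj₂ _) → refl })
         (λ { (_ , here p) → refl ; (_ , skip x) → refl }))
  (Fin+↔ (pulls c cs u)
    (count-merge k i pulls cs (Allₚ.++⁻ʳ (labels c) i∉ ∷ Unique-++⁻ʳ (labels c) u′)))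

-- For the two kinds with a gain, `suc` stands for `before` or `split`, and each improper edge from
-- `i` to a child gives one `merge`.
tops : Kind → List Tree → ℕ
tops plain []             = 1
tops plain (_ ∷ _)        = 0
tops elder []             = 0
tops elder (node i cs ∷ _) = suc (improperKids i cs)
tops impr  []             = 0
tops impr  (node i cs ∷ _) = suc (improperKids i cs)

sites : Kind → List Tree → ℕ
sites k []                 = tops k []
sites k (node v cs ∷ es) = tops k (node v cs ∷ es) + (sites k cs + sites k es)

sitesF : Kind → Forest → ℕ
sitesF k []               = 0
sitesF k (node v cs ∷ es) = sites k cs + sitesF k es

module Counting (N : ℕ) where
  open Insertion N

  count-top : ∀ k es → Unique (labelsF es) → ∃ (Top k es) ↔ Fin (tops k es)
  count-top plain []       u = Fin1↔ (_ , last) λ { (_ , last) → refl }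
  count-top plain (c ∷ es) u = Fin0↔ λ { (_ , merge x) → merge-not-plain x }
  count-top elder []       u = Fin0↔ λ ()
  count-top elder (node i cs ∷ es) (i∉ ∷ u) = ↔-trans
    (mk↔ₛ′ (λ { (_ , before) → inj₁ tt ; (_ , merge x) → inj₂ (_ , x) })
           (λ { (inj₁ _) → _ , before ; (inj₂ (_ , x)) → _ , merge x })
           (λ { (inj₁ _) → refl ; (inj₂ _) → refl })
           (λ { (_ , before) → refl ; (_ , merge x) → refl }))
    (Fin+↔ (Fin1↔ tt λ _ → refl) (count-merge elder i (count-pull-elder i) cs
      (Allₚ.++⁻ˡ (labelsF cs) i∉ ∷ Unique-++⁻ˡ (labelsF cs) u)))
  count-top impr  []       u = Fin0↔ λ ()
  count-top impr  (node i cs ∷ es) (i∉ ∷ u) = ↔-trans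
    (mk↔ₛ′ (λ { (_ , split) → inj₁ tt ; (_ , merge x) → inj₂ (_ , x) })
           (λ { (inj₁ _) → _ , split ; (inj₂ (_ , x)) → _ , merge x })
           (λ { (inj₁ _) → refl ; (inj₂ _) → refl })
           (λ { (_ , split) → refl ; (_ , merge x) → refl }))
    (Fin+↔ (Fin1↔ tt λ _ → refl) (count-merge impr i (count-pull-impr i) cs
      (Allₚ.++⁻ˡ (labelsF cs) i∉ ∷ Unique-++⁻ˡ (labelsF cs) u)))

  count-ins : ∀ k es → Unique (labelsF es) → ∃ (Ins k es) ↔ Fin (sites k es)
  count-ins k [] u = ↔-trans
    (mk↔ₛ′ (λ { (_ , top t) → _ , t }) (λ { (_ , t) → _ , top t })
           (λ _ → refl) (λ { (_ , top t) → refl }))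
    (count-top k [] u)
  count-ins k es@(node v cs ∷ es₁) u@(_ ∷ u′) = ↔-trans
    (mk↔ₛ′ (λ { (_ , top t) → inj₁ (_ , t) ; (_ , inside x) → inj₂ (inj₁ (_ , x))
              ; (_ , later x) → inj₂ (inj₂ (_ , x)) })
           (λ { (inj₁ (_ , t)) → _ , top t ; (inj₂ (inj₁ (_ , x))) → _ , inside x
              ; (inj₂ (inj₂ (_ , x))) → _ , later x })
           (λ { (inj₁ _) → refl ; (inj₂ (inj₁ _)) → refl ; (inj₂ (inj₂ _)) → refl })
           (λ { (_ , top t) → refl ; (_ , inside x) → refl ; (_ , later x) → refl }))
    (Fin+↔ (count-top k es u)
      (Fin+↔ (count-ins k cs (Unique-++⁻ˡ (labelsF cs) u′))
             (count-ins k es₁ (Unique-++⁻ʳ (labelsF cs) u′))))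

  count-insF : ∀ k F → Unique (labelsF F) → ∃ (InsF k F) ↔ Fin (sitesF k F)
  count-insF k [] u = Fin0↔ λ ()
  count-insF k (node v cs ∷ es) (_ ∷ u) = ↔-trans
    (mk↔ₛ′ (λ { (_ , inside x) → inj₁ (_ , x) ; (_ , later x) → inj₂ (_ , x) })
           (λ { (inj₁ (_ , x)) → _ , inside x ; (inj₂ (_ , x)) → _ , later x })
           (λ { (inj₁ _) → refl ; (inj₂ _) → refl })
           (λ { (_ , inside x) → refl ; (_ , later x) → refl }))
    (Fin+↔ (count-ins k cs (Unique-++⁻ˡ (labelsF cs) u))
           (count-insF k es (Unique-++⁻ʳ (labelsF cs) u)))

-- Each vertex can receive a new last child; the `suc` is the leaf at the end of the list `es`
-- itself.
sites-plain : ∀ es → sites plain es ≡ suc (length (labelsF es))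
sites-plain []               = refl
sites-plain (node v cs ∷ es)
  rewrite sites-plain cs | sites-plain es | length-++ (labelsF cs) {labelsF es}
  = cong suc (+-suc (length (labelsF cs)) _)

-- Every vertex in `es` gives one site, and so does every improper edge inside the trees. Edges from
-- a common parent to the roots of `es` are not counted at this level.
sites-nonplain : ∀ k → (∀ v cs es → tops k (node v cs ∷ es) ≡ suc (improperKids v cs)) →
                 tops k [] ≡ 0 → ∀ es → sites k es ≡ length (labelsF es) + impTs es
sites-nonplain k eq∷ eq[] []               = eq[]
sites-nonplain k eq∷ eq[] (node v cs ∷ es)
  rewrite eq∷ v cs es | sites-nonplain k eq∷ eq[] cs | sites-nonplain k eq∷ eq[] es
        | length-++ (labelsF cs) {labelsF es}
  = cong suc (regroup (improperKids v cs) (length (labelsF cs)) (impTs cs)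
      (length (labelsF es)) (impTs es))
  where
  regroup : ∀ a b c d e → a + ((b + c) + (d + e)) ≡ (b + d) + ((a + c) + e)
  regroup = solve-∀

-- Labels of a forest: roots and non-roots

sort≡⇒↭ : ∀ {xs ys} → sort xs ≡ ys → xs ↭ ys
sort≡⇒↭ {xs} eq = ↭-trans (↭-sym (sort-↭ xs)) (↭-reflexive eq)

-- Two sorted lists that are permutations of each other coincide.
↭⇒sort≡ : ∀ {xs n} → xs ↭ applyUpTo suc n → sort xs ≡ applyUpTo suc n
↭⇒sort≡ {xs} {n} p = Pointwise-≡⇒≡ (Sortedₚ.↗↭↗⇒≋ ≤-totalOrder (sort-↗ xs)
  (Sortedₚ.applyUpTo⁺₂ ≤-totalOrder suc n (λ i → n≤1+n (suc i)))
  (↭⇒↭ₛ (↭-trans (sort-↭ xs) p)))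

applyUpTo-+ : ∀ (f : ℕ → ℕ) m n → applyUpTo f (m + n) ≡ applyUpTo f m ++ applyUpTo (f ∘ (m +_)) n
applyUpTo-+ f zero    n = refl
applyUpTo-+ f (suc m) n = cong (f 0 ∷_) (applyUpTo-+ (f ∘ suc) m n)

applyUpTo-suc-↭ : ∀ n → applyUpTo suc (suc n) ↭ suc n ∷ applyUpTo suc n
applyUpTo-suc-↭ n = ↭-trans (↭-reflexive (sym (applyUpTo-∷ʳ suc n)))
  (++-comm (applyUpTo suc n) (suc n ∷ []))

++-cancelˡ-↭ : ∀ (xs : List ℕ) {ys zs} → xs ++ ys ↭ xs ++ zs → ys ↭ zs
++-cancelˡ-↭ []       p = p
++-cancelˡ-↭ (x ∷ xs) p = ++-cancelˡ-↭ xs (drop-∷ p)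

below : Forest → List ℕ
below []               = []
below (node v cs ∷ F) = labelsF cs ++ below F

labels-below : ∀ F → labelsF F ↭ map root F ++ below F
labels-below []               = ↭-refl
labels-below (node v cs ∷ F) = prep v (↭-trans (++⁺ˡ (labelsF cs) (labels-below F))
  (shifts (labelsF cs) (map root F)))

module _ {n r : ℕ} {F : Forest} (isF : IsForest n r F) where
  labels-↭ : labelsF F ↭ applyUpTo suc n
  labels-↭ = sort≡⇒↭ (proj₂ isF)

  labels-unique : Unique (labelsF F)
  labels-unique = Unique-resp-↭ (↭-sym labels-↭)
    (Uniqueₚ.applyUpTo⁺₁ suc n (λ i<j _ eq → <⇒≢ i<j (suc-injective eq)))

  labels-bound : All (_< suc n) (labelsF F)
  labels-bound = All-resp-↭ (↭-sym labels-↭) (Allₚ.applyUpTo⁺₁ suc n (λ i<n → s≤s i<n))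

  labels-length : length (labelsF F) ≡ n
  labels-length = trans (↭-length labels-↭) (length-applyUpTo suc n)

  roots-bound : All (_≤ r) (map root F)
  roots-bound = subst (All (_≤ r)) (sym (proj₁ isF)) (Allₚ.applyUpTo⁺₁ suc r id)

-- Cancelling the roots `1,…,r` from the list of all labels leaves `r+1,…,r+m` for the other
-- vertices.
below-↭ : ∀ {r m F} → IsForest (r + m) r F → below F ↭ applyUpTo (suc ∘ (r +_)) m
below-↭ {r} {m} {F} isF = ++-cancelˡ-↭ (applyUpTo suc r) (↭-trans
  (↭-reflexive (cong (_++ below F) (sym (proj₁ isF))))
  (↭-trans (↭-sym (labels-below F)) (↭-trans (labels-↭ isF)
    (↭-reflexive (applyUpTo-+ suc r m)))))

below-bound : ∀ {r m F} → IsForest (r + m) r F → All (r <_) (below F)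
below-bound {r} {m} isF = All-resp-↭ (↭-sym (below-↭ isF))
  (Allₚ.applyUpTo⁺₂ _ m (λ i → s≤s (m≤m+n r i)))

below-length : ∀ {r m F} → IsForest (r + m) r F → length (below F) ≡ m
below-length {r} {m} isF = trans (↭-length (below-↭ isF)) (length-applyUpTo _ m)

improperKids-zero : ∀ v cs → All (v <_) (labelsF cs) → improperKids v cs ≡ 0
improperKids-zero v []       bd = refl
improperKids-zero v (c ∷ cs) bd
  rewrite <ᵇ-true (All.lookup bd (∈-++⁺ˡ {ys = labelsF cs} (β∈labels c))) | ∨-zeroʳ (isElder c cs)
  = improperKids-zero v cs (Allₚ.++⁻ʳ (labels c) bd)

sitesF-plain : ∀ F → sitesF plain F ≡ length (labelsF F)
sitesF-plain []               = refl
sitesF-plain (node v cs ∷ F)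
  rewrite sites-plain cs | sitesF-plain F = cong suc (sym (length-++ (labelsF cs)))

-- No insertion replaces a root, so edges leaving a root offer no merge. The roots carry the
-- smallest labels, hence these edges are all proper and the count still involves every improper
-- edge of `F`.
sitesF-nonplain : ∀ k → (∀ es → sites k es ≡ length (labelsF es) + impTs es) →
  ∀ {r} F → All (_≤ r) (map root F) → All (r <_) (below F) →
  sitesF k F ≡ length (below F) + improper F
sitesF-nonplain k eq []               rs bs = refl
sitesF-nonplain k eq (node v cs ∷ F) (v≤r ∷ rs) bs
  rewrite eq cs | sitesF-nonplain k eq F rs (Allₚ.++⁻ʳ (labelsF cs) bs)
        | improperKids-zero v cs (All.map (≤-<-trans v≤r) (Allₚ.++⁻ˡ (labelsF cs) bs))
        | length-++ (labelsF cs) {below F}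
  = interchange (length (labelsF cs)) (impTs cs) (length (below F)) (improper F)

ForestsWith-≡ : ∀ {n r k j} {x y : ForestsWith n r k j} → proj₁ x ≡ proj₁ y → x ≡ y
ForestsWith-≡ {x = _ , (a , b) , c , d} {_ , (a′ , b′) , c′ , d′} refl
  rewrite uip a a′ | uip b b′ | uip c c′ | uip d d′ = refl

-- From forests on `[n]` to forests on `[n + 1]`

module Step (r m : ℕ) where
  n N : ℕ
  n = r + m
  N = suc n

  open Insertion N
  open Removal N
  open Counting N

  -- `k` and `j` are the statistics after the insertion, so a kind with a gain has no extensions
  -- where the statistic in question is zero.
  Extension : Kind → ℕ → ℕ → Set
  Extension κ k j = Σ Forest λ F → IsForest n r F × ∃ (InsF κ F) ×
    improperGain κ + improper F ≡ k × elderGain κ + eld F ≡ j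

  module _ {k j : ℕ} where
    ∉-labels : ∀ {F} → IsForest n r F → N ∉ labelsF F
    ∉-labels isF N∈ = <-irrefl refl (All.lookup (labels-bound isF) N∈)

    insert : ∃ (λ κ → Extension κ k j) → ForestsWith N r k j
    insert (κ , F , isF@(eqr , _) , (F′ , x) , eqi , eqe) =
      F′ , (trans (insF-roots x) eqr , ↭⇒sort≡ perm) ,
      trans (insF-improper (labels-bound isF) x) eqi ,
      trans (insF-elder (labels-bound isF) x) eqe
      where
      perm : labelsF F′ ↭ applyUpTo suc N
      perm = ↭-trans (insF-labels x)
        (↭-trans (prep N (labels-↭ isF)) (↭-sym (applyUpTo-suc-↭ n)))

    find : ∀ {F′} → IsForest N r F′ → ∃₂ λ κ F → InsF κ F F′
    find {F′} isF = insF-exists F′ N∉roots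
      (∈-resp-↭ (↭-sym (labels-↭ isF)) (∈-applyUpTo⁺ suc (n<1+n n)))
      where
      N∉roots : N ∉ map root F′
      N∉roots N∈ = <⇒≱ (All.lookup (roots-bound isF) N∈) (m≤m+n r m)

    uninserted : ∀ {κ F F′} → IsForest N r F′ → InsF κ F F′ → IsForest n r F
    uninserted isF x = trans (sym (insF-roots x)) (proj₁ isF) ,
      ↭⇒sort≡ (drop-∷ (↭-trans (↭-sym (insF-labels x))
        (↭-trans (labels-↭ isF) (applyUpTo-suc-↭ n))))

    remove : ForestsWith N r k j → ∃ (λ κ → Extension κ k j)
    remove (F′ , isF′ , eqi , eqe) =
      let κ , F , x = find isF′
          isF = uninserted isF′ x
      in κ , F , isF , (F′ , x) ,
         trans (sym (insF-improper (labels-bound isF) x)) eqi ,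
         trans (sym (insF-elder (labels-bound isF) x)) eqe

    Extension-≡ : ∀ {F′} {y z : ∃₂ λ κ F → InsF κ F F′} → y ≡ z → ∀ {p q a b c d} →
      _≡_ {A = ∃ (λ κ → Extension κ k j)}
        (proj₁ y , proj₁ (proj₂ y) , p , (F′ , proj₂ (proj₂ y)) , a , b)
        (proj₁ z , proj₁ (proj₂ z) , q , (F′ , proj₂ (proj₂ z)) , c , d)
    Extension-≡ refl {p₁ , p₂} {q₁ , q₂} {a} {b} {c} {d}
      rewrite uip p₁ q₁ | uip p₂ q₂ | uip a c | uip b d = refl

    -- Removing and reinserting returns the same forest by construction. In the other order,
    -- `remove` may only find some insertion with the given result, and uniqueness identifies it
    -- with the original one.
    forests↔extensions : ForestsWith N r k j ↔ ∃ (λ κ → Extension κ k j)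
    forests↔extensions = mk↔ₛ′ remove insert
      (λ { e@(κ , F , isF , (F′ , x) , _) →
        let isF′ = proj₁ (proj₂ (insert e))
            _ , _ , y = find isF′
        in Extension-≡ (insF-unique (∉-labels (uninserted isF′ y)) (∉-labels isF) y x) })
      (λ _ → ForestsWith-≡ refl)

  -- The number of sites is the same `c` for all forests with `k` improper edges, so the dependent
  -- sum over forests becomes a product.
  count-extensions : ∀ κ {c num k j} →
    (∀ {F} → IsForest n r F → improper F ≡ k → sitesF κ F ≡ c) →
    ForestsWith n r k j ↔ Fin num →
    Extension κ (improperGain κ + k) (elderGain κ + j) ↔ Fin (c * num)
  count-extensions κ {c} {num} {k} {j} eq count = ↔-trans
    (mk↔ₛ′ {B = Σ (ForestsWith n r k j) λ F → ∃ (InsF κ (proj₁ F))}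
      (λ { (F , isF , x , a , b) →
        (F , isF , +-cancelˡ-≡ (improperGain κ) _ _ a , +-cancelˡ-≡ (elderGain κ) _ _ b) , x })
      (λ { ((F , isF , a , b) , x) →
        F , isF , x , cong (improperGain κ +_) a , cong (elderGain κ +_) b })
      (λ { ((F , isF , a , b) , x) → cong₂ (λ a b → (F , isF , a , b) , x) (uip _ _) (uip _ _) })
      (λ { (F , isF , x , a , b) → cong₂ (λ a b → F , isF , x , a , b) (uip _ _) (uip _ _) }))
    (↔-trans (Σ-↔ ↔-refl λ { {F , isF , a , b} →
        subst (λ s → ∃ (InsF κ F) ↔ Fin s) (eq isF a) (count-insF κ F (labels-unique isF)) })
      (↔-trans (mk↔ₛ′ (λ (a , b) → b , a) (λ (a , b) → b , a) (λ _ → refl) (λ _ → refl))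
        (↔-trans (↔-refl ×-↔ count) (↔-sym *↔×))))

  sites-elder : ∀ {k F} → IsForest n r F → improper F ≡ k → sitesF elder F ≡ m + k
  sites-elder {F = F} isF refl = trans
    (sitesF-nonplain elder (sites-nonplain elder (λ _ _ _ → refl) refl) F
      (roots-bound isF) (below-bound isF))
    (cong (_+ improper F) (below-length isF))

  sites-impr : ∀ {k F} → IsForest n r F → improper F ≡ k → sitesF impr F ≡ m + k
  sites-impr {F = F} isF refl = trans
    (sitesF-nonplain impr (sites-nonplain impr (λ _ _ _ → refl) refl) F
      (roots-bound isF) (below-bound isF))
    (cong (_+ improper F) (below-length isF))

-- The recurrence for the number of forests

prev : (ℕ → ℕ) → ℕ → ℕ
prev f zero    = 0
prev f (suc i) = f i

-- Here `m` counts the non-roots, `n = r + m`. At `m = 0` there is one forest, the `r` isolated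
-- roots. `prev` shifts an index as multiplication by a variable does, with value 0 at index 0.
forestCount : ℕ → ℕ → ℕ → ℕ → ℕ
forestCount r zero    zero    zero    = 1
forestCount r zero    zero    (suc j) = 0
forestCount r zero    (suc k) j       = 0
forestCount r (suc m) k       j       =
  (r + m) * forestCount r m k j +
  (prev (λ j′ → (m + k) * forestCount r m k j′) j +
   prev (λ k′ → (m + k′) * forestCount r m k′ j) k)

leaf : ℕ → Tree
leaf v = node v []

map-root-leaf : ∀ vs → map root (map leaf vs) ≡ vs
map-root-leaf vs = trans (sym (map-∘ vs)) (map-id vs)

labelsF-leaves : ∀ vs → labelsF (map leaf vs) ≡ vs
labelsF-leaves []       = refl
labelsF-leaves (v ∷ vs) = cong (v ∷_) (labelsF-leaves vs)

improper-leaves : ∀ vs → improper (map leaf vs) ≡ 0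
improper-leaves []       = refl
improper-leaves (v ∷ vs) = improper-leaves vs

eld-leaves : ∀ vs → eld (map leaf vs) ≡ 0
eld-leaves []       = refl
eld-leaves (v ∷ vs) = eld-leaves vs

below-[]⇒leaves : ∀ F → below F ≡ [] → F ≡ map leaf (map root F)
below-[]⇒leaves []               eq = refl
below-[]⇒leaves (node v [] ∷ F) eq = cong (leaf v ∷_) (below-[]⇒leaves F eq)
below-[]⇒leaves (node v (node _ _ ∷ _) ∷ F) ()

forest-leaves : ∀ {r F} → IsForest (r + 0) r F → F ≡ map leaf (applyUpTo suc r)
forest-leaves {F = F} isF = trans (below-[]⇒leaves F (↭-empty-inv (below-↭ isF)))
  (cong (map leaf) (proj₁ isF))

count-leaf-forests : ∀ r k j → ForestsWith (r + 0) r k j ↔ Fin (forestCount r 0 k j)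
count-leaf-forests r zero zero = Fin1↔
  (map leaf (applyUpTo suc r) ,
   (map-root-leaf _ , ↭⇒sort≡ {n = r + 0} (↭-reflexive
     (trans (labelsF-leaves _) (cong (applyUpTo suc) (sym (+-identityʳ r)))))) ,
   improper-leaves (applyUpTo suc r) , eld-leaves (applyUpTo suc r))
  (λ { (_ , isF , _) → ForestsWith-≡ (sym (forest-leaves isF)) })
count-leaf-forests r zero (suc j) = Fin0↔ λ { (F , isF , _ , eq) →
  0≢1+n (trans (sym (eld-leaves (applyUpTo suc r)))
    (trans (cong eld (sym (forest-leaves isF))) eq)) }
count-leaf-forests r (suc k) j = Fin0↔ λ { (F , isF , eq , _) →
  0≢1+n (trans (sym (improper-leaves (applyUpTo suc r)))
    (trans (cong improper (sym (forest-leaves isF))) eq)) }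

Kind-split : {P : Kind → Set} → ∃ P ↔ (P plain ⊎ (P elder ⊎ P impr))
Kind-split = mk↔ₛ′
  (λ { (plain , p) → inj₁ p ; (elder , p) → inj₂ (inj₁ p) ; (impr , p) → inj₂ (inj₂ p) })
  (λ { (inj₁ p) → plain , p ; (inj₂ (inj₁ p)) → elder , p ; (inj₂ (inj₂ p)) → impr , p })
  (λ { (inj₁ _) → refl ; (inj₂ (inj₁ _)) → refl ; (inj₂ (inj₂ _)) → refl })
  (λ { (plain , _) → refl ; (elder , _) → refl ; (impr , _) → refl })

count-forests : ∀ r m k j → ForestsWith (r + m) r k j ↔ Fin (forestCount r m k j)
count-forests r zero    k j = count-leaf-forests r k j
count-forests r (suc m) k j = subst (λ n → ForestsWith n r k j ↔ Fin (forestCount r (suc m) k j))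
  (sym (+-suc r m))
  (↔-trans forests↔extensions (↔-trans Kind-split
    (Fin+↔ (count-extensions plain
              (λ {F} isF _ → trans (sitesF-plain F) (labels-length isF)) (count-forests r m k j))
           (Fin+↔ (elders j) (imprs k)))))
  where
  open Step r m
  elders : ∀ j → Extension elder k j ↔ Fin (prev (λ j′ → (m + k) * forestCount r m k j′) j)
  elders zero    = Fin0↔ λ { (_ , _ , _ , _ , ()) }
  elders (suc j) = count-extensions elder sites-elder (count-forests r m k j)
  imprs : ∀ k → Extension impr k j ↔ Fin (prev (λ k′ → (m + k′) * forestCount r m k′ j) k)
  imprs zero    = Fin0↔ λ { (_ , _ , _ , () , _) }
  imprs (suc k) = count-extensions impr sites-impr (count-forests r m k j)

-- The coefficients of the polynomials satisfy the same recurrence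

module Coefficients (r : ℕ) where

  term : Mono → ℕ → ℕ → ℕ
  term mo k j = if (ey mo ≡ᵇ k) ∧ (et mo ≡ᵇ j) then coeff mo * r ^ ex mo else 0

  -- The coefficient of `y^k t^j` at `x = r`, `z = 1`, defined for every polynomial so that each
  -- summand of `stepOp` can be treated separately.
  coef : Poly → ℕ → ℕ → ℕ
  coef []        k j = 0
  coef (mo ∷ ms) k j = term mo k j + coef ms k j

  coef-unique : (f : Poly → ℕ) (k j : ℕ) → f [] ≡ 0 →
    (∀ mo ms → f (mo ∷ ms) ≡ term mo k j + f ms) → ∀ P → f P ≡ coef P k j
  coef-unique f k j f[] f∷ []        = f[]
  coef-unique f k j f[] f∷ (mo ∷ ms) =
    trans (f∷ mo ms) (cong (term mo k j +_) (coef-unique f k j f[] f∷ ms))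

  -- The local function of coeffQ has no name in scope: the underscore is solved by unification
  -- once Q m is generalised to a variable.
  coeffQ≡coef : ∀ m k j → coeffQ m k r j ≡ coef (Q m) k j
  coeffQ≡coef m k j with coef-unique _ k j refl (λ _ _ → refl) | Q m
  ... | unique | P = unique P

  coef-++ : ∀ P R k j → coef (P ++ R) k j ≡ coef P k j + coef R k j
  coef-++ []        R k j = refl
  coef-++ (mo ∷ ms) R k j =
    trans (cong (term mo k j +_) (coef-++ ms R k j)) (sym (+-assoc (term mo k j) _ _))

  coef-map : ∀ (f : Mono → Mono) c k j → (∀ mo → term (f mo) k j ≡ c * term mo k j) →
             ∀ P → coef (map f P) k j ≡ c * coef P k j
  coef-map f c k j eq []        = sym (*-zeroʳ c)
  coef-map f c k j eq (mo ∷ ms) =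
    trans (cong₂ _+_ (eq mo) (coef-map f c k j eq ms)) (sym (*-distribˡ-+ c (term mo k j) _))

  if-* : ∀ (b : Bool) c {x y} → x ≡ c * y → (if b then x else 0) ≡ c * (if b then y else 0)
  if-* true  c eq = eq
  if-* false c eq = sym (*-zeroʳ c)

  coef-mulX : ∀ P k j → coef (mulX P) k j ≡ r * coef P k j
  coef-mulX P k j = coef-map _ r k j
    (λ mo → if-* ((ey mo ≡ᵇ k) ∧ (et mo ≡ᵇ j)) r (x*yz≡y*xz (coeff mo) r (r ^ ex mo))) P

  coef-scale : ∀ c P k j → coef (scale c P) k j ≡ c * coef P k j
  coef-scale c P k j = coef-map _ c k j
    (λ mo → if-* ((ey mo ≡ᵇ k) ∧ (et mo ≡ᵇ j)) c (*-assoc c (coeff mo) (r ^ ex mo))) P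

  coef-mulZ : ∀ P k j → coef (mulZ P) k j ≡ coef P k j
  coef-mulZ []        k j = refl
  coef-mulZ (mo ∷ ms) k j = cong (term mo k j +_) (coef-mulZ ms k j)

  coef-yDy : ∀ P k j → coef (yDy P) k j ≡ k * coef P k j
  coef-yDy P k j = coef-map _ k k j term-yDy P
    where
    term-yDy : ∀ mo → (if (ey mo ≡ᵇ k) ∧ (et mo ≡ᵇ j) then ey mo * coeff mo * r ^ ex mo else 0)
                      ≡ k * term mo k j
    term-yDy mo with ey mo ≡ᵇ k in eq
    ... | false = sym (*-zeroʳ k)
    ... | true  = if-* (et mo ≡ᵇ j) k (trans (*-assoc (ey mo) (coeff mo) _)
      (cong (_* (coeff mo * r ^ ex mo)) (≡ᵇ⇒≡ (ey mo) k (Equivalence.from T-≡ eq))))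

  coef-mulY : ∀ P k j → coef (mulY P) k j ≡ prev (λ k′ → coef P k′ j) k
  coef-mulY []        zero    j = refl
  coef-mulY []        (suc k) j = refl
  coef-mulY (mo ∷ ms) zero    j = coef-mulY ms zero j
  coef-mulY (mo ∷ ms) (suc k) j = cong (term mo k j +_) (coef-mulY ms (suc k) j)

  coef-mulT : ∀ P k j → coef (mulT P) k j ≡ prev (coef P k) j
  coef-mulT []        k zero    = refl
  coef-mulT []        k (suc j) = refl
  coef-mulT (mo ∷ ms) k zero    rewrite ∧-zeroʳ (ey mo ≡ᵇ k) = coef-mulT ms k zero
  coef-mulT (mo ∷ ms) k (suc j) = cong (term mo k j +_) (coef-mulT ms k (suc j))

  prev-cong : ∀ {f g} → (∀ i → f i ≡ g i) → ∀ i → prev f i ≡ prev g i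
  prev-cong eq zero    = refl
  prev-cong eq (suc i) = eq i

  coef-stepOp : ∀ m P k j → coef (stepOp m P) k j ≡
    (r + m) * coef P k j +
    (prev (λ j′ → (m + k) * coef P k j′) j + prev (λ k′ → (m + k′) * coef P k′ j) k)
  coef-stepOp m P k j = begin
    coef (mulX P ++ scale m (mulZ P) ++ (mulY A ++ mulT A)) k j
      ≡⟨ coef-++ (mulX P) _ k j ⟩
    coef (mulX P) k j + coef (scale m (mulZ P) ++ (mulY A ++ mulT A)) k j
      ≡⟨ cong₂ _+_ (coef-mulX P k j) (coef-++ (scale m (mulZ P)) _ k j) ⟩
    r * coef P k j + (coef (scale m (mulZ P)) k j + coef (mulY A ++ mulT A) k j)
      ≡⟨ cong (r * coef P k j +_) (cong₂ _+_
           (trans (coef-scale m (mulZ P) k j) (cong (m *_) (coef-mulZ P k j)))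
           -- The part from `t` is put first, as in `forestCount`.
           (trans (coef-++ (mulY A) (mulT A) k j) (+-comm (coef (mulY A) k j) _))) ⟩
    r * coef P k j + (m * coef P k j + (coef (mulT A) k j + coef (mulY A) k j))
      ≡⟨ +-assoc (r * coef P k j) _ _ ⟨
    (r * coef P k j + m * coef P k j) + (coef (mulT A) k j + coef (mulY A) k j)
      ≡⟨ cong₂ _+_ (sym (*-distribʳ-+ (coef P k j) r m)) (cong₂ _+_
           (trans (coef-mulT A k j) (prev-cong (coef-A k) j))
           (trans (coef-mulY A k j) (prev-cong (λ k′ → coef-A k′ j) k))) ⟩
    (r + m) * coef P k j +
    (prev (λ j′ → (m + k) * coef P k j′) j + prev (λ k′ → (m + k′) * coef P k′ j) k) ∎
    where
    open ≡-Reasoning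
    A : Poly
    A = scale m P ++ yDy P
    coef-A : ∀ k j → coef A k j ≡ (m + k) * coef P k j
    coef-A k j = trans (coef-++ (scale m P) (yDy P) k j)
      (trans (cong₂ _+_ (coef-scale m P k j) (coef-yDy P k j)) (sym (*-distribʳ-+ (coef P k j) m k)))

  *-prev : ∀ c f i → c * prev f i ≡ prev (λ i′ → c * f i′) i
  *-prev c f zero    = *-zeroʳ c
  *-prev c f (suc i) = refl

  -- The recurrences are linear and agree, so the factor `r` passes through. They are matched from
  -- one non-root on, where `Q 1 = 1` meets the `r` ways to hang one leaf on a root.
  forestCount-Q : ∀ m k j → r * coef (Q (suc m)) k j ≡ forestCount r (suc m) k j
  forestCount-Q zero zero    zero    = base r
    where
    base : ∀ r → r * 1 ≡ (r + 0) * 1 + 0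
    base = solve-∀
  forestCount-Q zero zero    (suc j) = base r
    where
    base : ∀ r → r * 0 ≡ (r + 0) * 0 + 0
    base = solve-∀
  forestCount-Q zero (suc k) j       = trans (*-zeroʳ r) (sym (cong₂ _+_ (*-zeroʳ (r + 0))
    (cong₂ _+_ (elders j) (imprs k))))
    where
    elders : ∀ j → prev (λ j′ → suc k * forestCount r 0 (suc k) j′) j ≡ 0
    elders zero    = refl
    elders (suc j) = *-zeroʳ (suc k)
    -- For `k = 0` the factor vanishes, for larger `k` the number of forests without non-roots does.
    imprs : ∀ k → k * forestCount r 0 k j ≡ 0
    imprs zero    = refl
    imprs (suc k) = *-zeroʳ (suc k)
  forestCount-Q (suc m) k j = begin
    r * coef (stepOp (suc m) P) k j
      ≡⟨ cong (r *_) (coef-stepOp (suc m) P k j) ⟩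
    r * ((r + suc m) * coef P k j + (prev e j + prev i k))
      ≡⟨ trans (*-distribˡ-+ r _ _)
           (cong (r * ((r + suc m) * coef P k j) +_) (*-distribˡ-+ r (prev e j) _)) ⟩
    r * ((r + suc m) * coef P k j) + (r * prev e j + r * prev i k)
      ≡⟨ cong₂ _+_ (pull (r + suc m) k j) (cong₂ _+_
           (trans (*-prev r e j) (prev-cong (λ j′ → pull (suc m + k) k j′) j))
           (trans (*-prev r i k) (prev-cong (λ k′ → pull (suc m + k′) k′ j) k))) ⟩
    forestCount r (suc (suc m)) k j ∎
    where
    open ≡-Reasoning
    P : Poly
    P = Q (suc m)
    e i : ℕ → ℕ
    e j′ = (suc m + k) * coef P k j′
    i k′ = (suc m + k′) * coef P k′ j
    pull : ∀ c k j → r * (c * coef P k j) ≡ c * forestCount r (suc m) k j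
    pull c k j = trans (x*yz≡y*xz r c _) (cong (c *_) (forestCount-Q m k j))

open Coefficients

theorem5p1 : (r n k j : ℕ) → 1 ≤ r → r < n →
    Fin (r * coeffQ (n ∸ r) k r j) ↔ ForestsWith n r k j
theorem5p1 r n k j _ r<n with n ∸ r in n∸r≡ | m+[n∸m]≡n (<⇒≤ r<n)
... | zero  | _    = contradiction n∸r≡ (m>n⇒m∸n≢0 r<n)
... | suc m | refl = subst (λ c → Fin c ↔ ForestsWith (r + suc m) r k j)
  (sym (trans (cong (r *_) (coeffQ≡coef r (suc m) k j)) (forestCount-Q r m k j)))
  (↔-sym (count-forests r (suc m) k j))
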